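{- Let $G$ be a $k$-subset of permutations in $\mathrm{Sym}(n)$ chosen uniformly at random from all such $k$-subsets. Then the typical (expected) number $c_i$ of non-trivial switches in row $i$ of a switch table for $G$, for $i=1,2,\dots,n$, is given by $$\mathbb{E}[c_i]=(n-i)\Bigl(1-\prod_{t=0}^{k-1}\Bigl(1-\frac{(n-i)!}{n!-t}\Bigr)\Bigr).$$ If $k$ is sufficiently smaller than $n!$, a binomial approximation of this is given as follows: let $G$ be a random sequence of $k$ permutations in $\mathrm{Sym}(n)$, each chosen uniformly and independently at random with replacement. Then the typical (expected) number $c_i$ of non-trivial switches in row $i$, for $i=1,2,\dots,n$, is given by $$\mathbb{E}[c_i]=(n-i)\Bigl(1-\Bigl(1-\frac{1}{(n)_i}\Bigr)^{k}\Bigr).$$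
   Context: For a set (or sequence) $G$ of permutations of $\{1,\dots,n\}$, the entry in row $i$ and column $j$ of a switch table for $G$ is non-trivial if and only if $j>i$ and there is a $\pi$ in $G$ with $\pi(t)=t$ for all $t<i$ and $\pi(j)=i$. Thus $c_i$ is the number of $j\in\{i+1,\dots,n\}$ for which such a $\pi$ exists. $(n)_i:=n(n-1)\cdots(n-i+1)$. -}

module Defs where

open import Data.Fin.Base using (Fin; zero; suc; toℕ; _<_; punchIn; punchOut)
open import Data.Fin.Permutation
  using (Permutation′; _⟨$⟩ʳ_; _⟨$⟩ˡ_; _≈_; id; insert; remove; inverseʳ; inverseˡ;
         insert-remove; insert-punchIn)
open import Data.Fin.Properties using (_≟_; _<?_; all?; toℕ<n; punchIn-injective)
open import Data.Integer.Base using (+_)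
open import Data.List.Base
  using (List; []; _∷_; [_]; _++_; map; cartesianProductWith; allFin; filter; length)
open import Data.List.Membership.Propositional.Properties using (∈-allFin)
open import Data.List.Properties using (length-map; length-++; length-tabulate)
open import Data.List.Relation.Unary.All as All using (All; []; _∷_)
import Data.List.Relation.Unary.All.Properties as All
open import Data.List.Relation.Unary.AllPairs as AllPairs using (AllPairs; []; _∷_)
import Data.List.Relation.Unary.AllPairs.Properties as AllPairs
open import Data.List.Relation.Unary.Any as Any using (Any; here; any?)
import Data.List.Relation.Unary.Any.Properties as Any
open import Data.List.Relation.Unary.Unique.Propositional using (Unique)
open import Data.List.Relation.Unary.Unique.Propositional.Properties using (allFin⁺)
open import Data.Nat.Base as ℕ
  using (ℕ; zero; suc; _+_; _*_; _∸_; _^_; _!; _≤_; z≤n; s≤s; NonZero; >-nonZero; >-nonZero⁻¹)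
import Data.Nat.Properties as ℕ
open import Data.Nat.Combinatorics using (_P_; nPk≡n!/[n∸k]!)
open import Data.Nat.ListAction using (sum)
open import Data.Nat.DivMod using (m≥n⇒m/n>0)
open import Data.Product.Base using (_×_; _,_)
open import Data.Rational.Base using (ℚ; _/_)
open import Level using (Level)
open import Relation.Binary.PropositionalEquality
  using (_≡_; _≢_; refl; sym; trans; cong; cong₂; subst)
open import Relation.Nullary using (¬_; Dec; yes; no; contradiction)
open import Relation.Nullary.Decidable using (_×-dec_; _→-dec_)

private
  variable
    a : Level
    A B C : Set a

-- Points and rows are 0-based: i : Fin n stands for row suc (toℕ i).

Switch : ∀ {n} → Fin n → Fin n → Permutation′ n → Set
Switch i j π = (∀ t → t < i → π ⟨$⟩ʳ t ≡ t) × π ⟨$⟩ʳ j ≡ i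

NonTrivial : ∀ {n} → List (Permutation′ n) → Fin n → Fin n → Set
NonTrivial G i j = i < j × Any (Switch i j) G

nonTrivial? : ∀ {n} (G : List (Permutation′ n)) (i j : Fin n) → Dec (NonTrivial G i j)
nonTrivial? G i j = (i <? j) ×-dec any? switch? G
  where
  switch? : ∀ π → Dec (Switch i j π)
  switch? π = all? (λ t → (t <? i) →-dec (π ⟨$⟩ʳ t ≟ t)) ×-dec (π ⟨$⟩ʳ j ≟ i)

c : ∀ {n} → Fin n → List (Permutation′ n) → ℕ
c {n} i G = length (filter (nonTrivial? G i) (allFin n))

-- Each permutation of Fin n exactly once up to _≈_ (propositional equality
-- of Permutation′ n is too fine without function extensionality); the first
-- factor runs over the preimage of zero.
Sym : ∀ n → List (Permutation′ n)
Sym zero    = [ id ]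
Sym (suc n) = cartesianProductWith (λ j π → insert j zero π) (allFin (suc n)) (Sym n)

-- Subsets are picked by position, so when xs has no repetitions every
-- k-element subset of xs is listed exactly once.
subsets : ℕ → List A → List (List A)
subsets zero    xs       = [ [] ]
subsets (suc k) []       = []
subsets (suc k) (x ∷ xs) = map (x ∷_) (subsets k xs) ++ subsets (suc k) xs

sequences : ℕ → List A → List (List A)
sequences zero    xs = [ [] ]
sequences (suc k) xs = cartesianProductWith _∷_ xs (sequences k xs)

-- Expectation of X under the uniform distribution on the entries of Ω.
𝔼 : (Ω : List A) .{{_ : NonZero (length Ω)}} → (A → ℕ) → ℚ
𝔼 Ω X = + sum (map X Ω) / length Ω

length-product : (f : A → B → C) (xs : List A) (ys : List B) →
                 length (cartesianProductWith f xs ys) ≡ length xs * length ys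
length-product f []       ys = refl
length-product f (x ∷ xs) ys = trans (length-++ (map (f x) ys))
  (cong₂ _+_ (length-map (f x) ys) (length-product f xs ys))

Sym-length : ∀ n → length (Sym n) ≡ n !
Sym-length zero    = refl
Sym-length (suc n) = trans (length-product (λ j → insert j zero) (allFin (suc n)) (Sym n))
  (cong₂ _*_ (length-tabulate {n = suc n} (λ j → j)) (Sym-length n))

sequences-length : ∀ k (xs : List A) → length (sequences k xs) ≡ length xs ^ k
sequences-length zero    xs = refl
sequences-length (suc k) xs = trans (length-product _∷_ xs (sequences k xs))
  (cong (length xs *_) (sequences-length k xs))

subsets-nonZero : ∀ {k} (xs : List A) → k ≤ length xs → NonZero (length (subsets k xs))
subsets-nonZero {k = zero}  xs       _         = _
subsets-nonZero {k = suc k} (x ∷ xs) (s≤s k≤n) =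
  subst NonZero (sym (length-++ (map (x ∷_) (subsets k xs))))
    (>-nonZero (ℕ.m≤n⇒m≤n+o _
      (subst (0 ℕ.<_) (sym (length-map (x ∷_) (subsets k xs)))
        (>-nonZero⁻¹ _ {{subsets-nonZero xs k≤n}}))))

Sym-subsets-nonZero : ∀ {n k} → k ≤ n ! → NonZero (length (subsets k (Sym n)))
Sym-subsets-nonZero {n} k≤n! =
  subsets-nonZero (Sym n) (subst (_ ≤_) (sym (Sym-length n)) k≤n!)

Sym-sequences-nonZero : ∀ n k → NonZero (length (sequences k (Sym n)))
Sym-sequences-nonZero n k = subst NonZero
  (sym (trans (sequences-length k (Sym n)) (cong (_^ k) (Sym-length n))))
  (ℕ.m^n≢0 (n !) k {{n ℕ.!≢0}})

∸-nonZero : ∀ {k m} → k ≤ m → (t : Fin k) → NonZero (m ∸ toℕ t)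
∸-nonZero k≤m t = >-nonZero (ℕ.m<n⇒0<n∸m (ℕ.<-≤-trans (toℕ<n t) k≤m))

P-nonZero : ∀ {n k} → k ≤ n → NonZero (n P k)
P-nonZero {n} {k} k≤n = >-nonZero (subst (0 ℕ.<_) (sym (nPk≡n!/[n∸k]! k≤n))
  (m≥n⇒m/n>0 {{(n ∸ k) ℕ.!≢0}} (!-mono (ℕ.m∸n≤m n k))))
  where
  !-mono : ∀ {l m} → l ≤ m → l ! ≤ m !
  !-mono {m = m} z≤n       = >-nonZero⁻¹ (m !) {{m ℕ.!≢0}}
  !-mono         (s≤s l≤m) = ℕ.*-mono-≤ (s≤s l≤m) (!-mono l≤m)

insert-at : ∀ {n} i j (π : Permutation′ n) → insert i j π ⟨$⟩ʳ i ≡ j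
insert-at i j π with i ≟ i
... | yes _  = refl
... | no i≢i = contradiction refl i≢i

insert-cong : ∀ {n} i j {π ρ : Permutation′ n} → π ≈ ρ → insert i j π ≈ insert i j ρ
insert-cong i j π≈ρ k with i ≟ k
... | yes _  = refl
... | no i≢k = cong (punchIn j) (π≈ρ (punchOut i≢k))

Sym-complete : ∀ {n} (π : Permutation′ n) → Any (π ≈_) (Sym n)
Sym-complete {zero}  π = here λ ()
Sym-complete {suc n} π =
  Any.cartesianProductWith⁺ (λ j π → insert j zero π)
    (λ { {_} {ρ} refl π′≈ρ k → trans (sym (π≈ k)) (insert-cong j zero π′≈ρ k) })
    (∈-allFin j) (Sym-complete (remove j π))
  where
  j : Fin (suc n)
  j = π ⟨$⟩ˡ zero

  π≈ : insert j zero (remove j π) ≈ π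
  π≈ k = trans (cong (λ l → insert j l (remove j π) ⟨$⟩ʳ k) (sym (inverseʳ π)))
               (insert-remove j π k)

Sym-distinct : ∀ n → AllPairs (λ π ρ → ¬ π ≈ ρ) (Sym n)
Sym-distinct zero    = [] ∷ []
Sym-distinct (suc n) = rows (allFin⁺ (suc n))
  where
  ins : Fin (suc n) → Permutation′ n → Permutation′ (suc n)
  ins j π = insert j zero π

  ins-injectiveˡ : ∀ j j′ π ρ → ins j π ≈ ins j′ ρ → j ≡ j′
  ins-injectiveˡ j j′ π ρ eq =
    trans (sym (inverseˡ (ins j′ ρ)))
      (trans (cong (ins j′ ρ ⟨$⟩ˡ_) (trans (sym (eq j)) (insert-at j zero π)))
        (trans (cong (ins j′ ρ ⟨$⟩ˡ_) (sym (insert-at j′ zero ρ))) (inverseˡ (ins j′ ρ))))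

  ins-injectiveʳ : ∀ j π ρ → ins j π ≈ ins j ρ → π ≈ ρ
  ins-injectiveʳ j π ρ eq k = punchIn-injective zero _ _
    (trans (sym (insert-punchIn j zero π k))
      (trans (eq (punchIn j k)) (insert-punchIn j zero ρ k)))

  apart : ∀ {j js} π → All (j ≢_) js →
          All (λ ρ → ¬ ins j π ≈ ρ) (cartesianProductWith ins js (Sym n))
  apart π []               = []
  apart π (j≢j′ ∷ j≢js) = All.++⁺
    (All.map⁺ (All.universal (λ ρ eq → j≢j′ (ins-injectiveˡ _ _ π ρ eq)) (Sym n)))
    (apart π j≢js)

  rows : ∀ {js} → Unique js →
         AllPairs (λ π ρ → ¬ π ≈ ρ) (cartesianProductWith ins js (Sym n))
  rows []                  = []
  rows {j ∷ _} (j≢js ∷ js!) = AllPairs.++⁺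
    (AllPairs.map⁺ (AllPairs.map (λ {π} {ρ} π≉ρ eq → π≉ρ (ins-injectiveʳ j π ρ eq)) (Sym-distinct n)))
    (rows js!)
    (All.map⁺ (All.universal (λ π → apart π j≢js) (Sym n)))

{-# OPTIONS --safe #-}
module Submission where

-- By linearity of expectation, E[c i] is (n - r) times the probability that a
-- given column j > i is hit. Exactly m = (n - r)! permutations realise the switch
-- (i, j), whatever j ≥ i is, so among the C(N, k) subsets (N ^ k sequences) of
-- Sym n, N = n!, there are C(N - m, k) (resp. (N - m) ^ k) that miss the column.
-- The quotient of binomials telescopes into the product by absorption,
-- C(l + 1, k + 1) / C(n + 1, k + 1) = (l + 1)/(n + 1) · C(l, k) / C(n, k), and
-- m / N = 1 / (n P r) gives the power.

open import Defs
open import Algebra.Properties.CommutativeSemigroup using (x∙yz≈y∙xz)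
open import Data.Bool.Base using (true; false)
open import Data.Fin.Base using (Fin; zero; suc; toℕ; _<_)
open import Data.Fin.Permutation
  using (Permutation′; _⟨$⟩ʳ_; _⟨$⟩ˡ_; insert; inverseˡ; insert-punchIn)
open import Data.Fin.Properties using (toℕ<n; _≟_; _<?_; all?; suc-injective)
open import Data.Integer.Base using (+_)
import Data.Integer.Base as ℤ
import Data.Integer.Properties as ℤ
open import Data.List.Base
  using (List; []; _∷_; _++_; map; cartesianProductWith; allFin; filter; length)
open import Data.List.Properties
  using (filter-++; filter-≐; filter-none; filter-all; length-filter; length-++; length-map;
         length-tabulate; map-tabulate)
import Data.List.Relation.Unary.All as All
import Data.List.Relation.Unary.All.Properties as All
open import Data.List.Relation.Unary.Any using (Any; here; there; any?)
open import Data.Nat.Base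
  using (ℕ; zero; suc; _∸_; _!; _≤_; z≤n; s≤s; NonZero; >-nonZero⁻¹)
import Data.Nat.Base as ℕ
open import Data.Nat.Combinatorics
  using (_P_; _C_; nPk≡n!/[n∸k]!; nC1≡n; nCk+nC[k+1]≡[n+1]C[k+1])
open import Data.Nat.DivMod using (m/n*n≡m)
open import Data.Nat.Divisibility using (m≤n⇒m!∣n!; ∣⇒≤)
open import Data.Nat.ListAction using (sum)
import Data.Nat.Properties as ℕ
open import Data.Nat.Tactic.RingSolver using (solve-∀)
open import Data.Product.Base using (_×_; _,_; proj₁; proj₂)
open import Data.Rational.Base using (ℚ; 1ℚ; _/_; _-_; _*_; +-*-rawSemiring; toℚᵘ)
import Data.Rational.Base as ℚ
import Data.Rational.Properties as ℚ
open import Data.Rational.Unnormalised.Base using (mkℚᵘ; *≡*)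
import Data.Rational.Unnormalised.Base as ℚᵘ
import Data.Rational.Unnormalised.Properties as ℚᵘ
open import Data.Unit.Base using (tt)
open import Algebra.Definitions.RawSemiring +-*-rawSemiring using (_^_) renaming (product to ∏)
open import Function.Base using (_∘_; id)
open import Level using (Level)
open import Relation.Binary.PropositionalEquality
  using (_≡_; refl; sym; trans; cong; cong₂; subst; module ≡-Reasoning)
open import Relation.Nullary using (¬_; Dec; yes; no; does)
open import Relation.Nullary.Decidable using (_×-dec_; _→-dec_)
open import Relation.Unary using (Pred; Decidable; ∁)
open import Relation.Unary.Properties using (∁?; U?)

private
  variable
    a p q ℓ : Level
    A B X : Set a

-- Counting filtered entries of maps and products.

module _ {E : Pred B p} (E? : Decidable E) where

  length-filter-map : (f : A → B) (xs : List A) →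
                      length (filter E? (map f xs)) ≡ length (filter (E? ∘ f) xs)
  length-filter-map f []       = refl
  length-filter-map f (x ∷ xs) with does (E? (f x))
  ... | true  = cong suc (length-filter-map f xs)
  ... | false = length-filter-map f xs

  length-filter-∁ : ∀ xs → length (filter E? xs) ℕ.+ length (filter (∁? E?) xs) ≡ length xs
  length-filter-∁ []       = refl
  length-filter-∁ (x ∷ xs) with does (E? x)
  ... | true  = cong suc (length-filter-∁ xs)
  ... | false = trans (ℕ.+-suc _ _) (cong suc (length-filter-∁ xs))

  length-filter-∸ : ∀ xs → length (filter E? xs) ≡ length xs ∸ length (filter (∁? E?) xs)
  length-filter-∸ xs = trans (sym (ℕ.m+n∸n≡m _ (length (filter (∁? E?) xs))))
    (cong (_∸ length (filter (∁? E?) xs)) (length-filter-∁ xs))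

module _ {E : Pred A p} {R : Pred B ℓ} {Q : Pred X q}
         (E? : Decidable E) (R? : Decidable R) (Q? : Decidable Q) (f : A → B → X)
         (to : ∀ {x y} → Q (f x y) → E x × R y) (from : ∀ {x y} → E x → R y → Q (f x y)) where

  -- Kept to a single `x`, since `subsets` is built from one such `map` at a time rather than from a
  -- full product.
  length-filter-map-accept : ∀ {x} → E x → ∀ ys →
                             length (filter Q? (map (f x) ys)) ≡ length (filter R? ys)
  length-filter-map-accept px ys = trans (length-filter-map Q? (f _) ys)
    (cong length (filter-≐ (Q? ∘ f _) R? ((λ q → proj₂ (to q)) , from px) ys))

  length-filter-map-reject : ∀ {x} → ¬ E x → ∀ ys → length (filter Q? (map (f x) ys)) ≡ 0
  length-filter-map-reject ¬px ys =
    cong length (filter-none Q? (All.map⁺ (All.universal (λ _ q → ¬px (proj₁ (to q))) ys)))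

  -- By `to` and `from`, `Q` at `f x y` is the conjunction of `E x` and `R y`, so each `x`
  -- contributes either the whole count of `R` or nothing.
  length-filter-product : ∀ xs ys → length (filter Q? (cartesianProductWith f xs ys))
                                      ≡ length (filter E? xs) ℕ.* length (filter R? ys)
  length-filter-product []       ys = refl
  length-filter-product (x ∷ xs) ys = begin
    length (filter Q? (map (f x) ys ++ cartesianProductWith f xs ys))
      ≡⟨ cong length (filter-++ Q? (map (f x) ys) _) ⟩
    length (filter Q? (map (f x) ys) ++ filter Q? (cartesianProductWith f xs ys))
      ≡⟨ length-++ (filter Q? (map (f x) ys)) ⟩
    length (filter Q? (map (f x) ys)) ℕ.+ length (filter Q? (cartesianProductWith f xs ys))
      ≡⟨ cong (length (filter Q? (map (f x) ys)) ℕ.+_) (length-filter-product xs ys) ⟩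
    length (filter Q? (map (f x) ys)) ℕ.+ length (filter E? xs) ℕ.* length (filter R? ys)
      ≡⟨ step ⟩
    length (filter E? (x ∷ xs)) ℕ.* length (filter R? ys) ∎
    where
    open ≡-Reasoning
    step : length (filter Q? (map (f x) ys)) ℕ.+ length (filter E? xs) ℕ.* length (filter R? ys)
             ≡ length (filter E? (x ∷ xs)) ℕ.* length (filter R? ys)
    step with E? x
    ... | yes px = cong (ℕ._+ _) (length-filter-map-accept px ys)
    ... | no ¬px = cong (ℕ._+ _) (length-filter-map-reject ¬px ys)

-- Sequences and subsets that miss an event.

module _ {E : Pred A p} (E? : Decidable E) where

  private
    none? : Decidable (∁ (Any E))
    none? = ∁? (any? E?)

    none-uncons : ∀ {x xs} → ¬ Any E (x ∷ xs) → ¬ E x × ¬ Any E xs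
    none-uncons ¬any = ¬any ∘ here , ¬any ∘ there

    none-cons : ∀ {x xs} → ¬ E x → ¬ Any E xs → ¬ Any E (x ∷ xs)
    none-cons ¬px ¬any (here px)  = ¬px px
    none-cons ¬px ¬any (there pxs) = ¬any pxs

  -- Missing `E` is a condition on the head and, independently, on the tail, so the counts multiply.
  sequences-none : ∀ k xs → length (filter none? (sequences k xs))
                              ≡ length (filter (∁? E?) xs) ℕ.^ k
  sequences-none zero    xs = refl
  sequences-none (suc k) xs = trans
    (length-filter-product (∁? E?) none? none? _∷_ none-uncons none-cons xs (sequences k xs))
    (cong (length (filter (∁? E?) xs) ℕ.*_) (sequences-none k xs))

  -- A subset that misses `E` is a subset of the entries outside `E`; the recursion of `subsets` is
  -- then Pascal's rule on their number.
  subsets-none : ∀ k xs → length (filter none? (subsets k xs))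
                            ≡ length (filter (∁? E?) xs) C k
  subsets-none zero    xs       = refl
  subsets-none (suc k) []       = refl
  subsets-none (suc k) (x ∷ xs) = begin
    length (filter none? (map (x ∷_) (subsets k xs) ++ subsets (suc k) xs))
      ≡⟨ cong length (filter-++ none? (map (x ∷_) (subsets k xs)) _) ⟩
    length (filter none? (map (x ∷_) (subsets k xs)) ++ filter none? (subsets (suc k) xs))
      ≡⟨ length-++ (filter none? (map (x ∷_) (subsets k xs))) ⟩
    length (filter none? (map (x ∷_) (subsets k xs))) ℕ.+ length (filter none? (subsets (suc k) xs))
      ≡⟨ cong (length (filter none? (map (x ∷_) (subsets k xs))) ℕ.+_) (subsets-none (suc k) xs) ⟩
    length (filter none? (map (x ∷_) (subsets k xs))) ℕ.+ length (filter (∁? E?) xs) C suc k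
      ≡⟨ step ⟩
    length (filter (∁? E?) (x ∷ xs)) C suc k ∎
    where
    open ≡-Reasoning
    step : length (filter none? (map (x ∷_) (subsets k xs))) ℕ.+ length (filter (∁? E?) xs) C suc k
             ≡ length (filter (∁? E?) (x ∷ xs)) C suc k
    step with E? x
    -- Every subset through `x` meets `E`, and `x` is dropped from the entries outside `E`, so only
    -- the second summand survives.
    ... | yes px = cong (ℕ._+ _)
      (length-filter-map-reject (∁? E?) none? none? _∷_ none-uncons none-cons
        (λ ¬px → ¬px px) (subsets k xs))
    ... | no ¬px = trans
      (cong (ℕ._+ _) (trans
        (length-filter-map-accept (∁? E?) none? none? _∷_ none-uncons none-cons
          ¬px (subsets k xs))
        (subsets-none k xs)))
      (nCk+nC[k+1]≡[n+1]C[k+1] (length (filter (∁? E?) xs)) k)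

subsets-length : ∀ k (xs : List A) → length (subsets k xs) ≡ length xs C k
subsets-length zero    xs       = refl
subsets-length (suc k) []       = refl
subsets-length (suc k) (x ∷ xs) = trans (length-++ (map (x ∷_) (subsets k xs)))
  (trans
    (cong₂ ℕ._+_ (trans (length-map (x ∷_) (subsets k xs)) (subsets-length k xs))
                 (subsets-length (suc k) xs))
    (nCk+nC[k+1]≡[n+1]C[k+1] (length xs) k))

-- Exchanging the order of summation.

module _ {R : A → B → Set ℓ} (R? : ∀ x y → Dec (R x y)) where

  -- Linearity of expectation in counting form: with lists `G` for `xs` and columns `j` for `ys`, it
  -- turns the total of `c` into a sum over columns.
  double-count : ∀ xs ys → sum (map (λ x → length (filter (R? x) ys)) xs)
                             ≡ sum (map (λ y → length (filter (λ x → R? x y) xs)) ys)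
  double-count []       []       = refl
  double-count []       (y ∷ ys) = double-count [] ys
  double-count (x ∷ xs) ys       =
    trans (cong (length (filter (R? x) ys) ℕ.+_) (double-count xs ys)) (step ys)
    where
    count : B → ℕ
    count y = length (filter (λ x → R? x y) xs)

    swap : ∀ y ys → length (filter (R? x) ys) ℕ.+ (count y ℕ.+ sum (map count ys))
                      ≡ count y ℕ.+ (length (filter (R? x) ys) ℕ.+ sum (map count ys))
    swap y ys = x∙yz≈y∙xz ℕ.+-commutativeSemigroup (length (filter (R? x) ys)) (count y) (sum (map count ys))

    -- The row of the new `x` is spread over the columns: each `y` related to `x` has its count
    -- raised by one.
    step : ∀ ys → length (filter (R? x) ys) ℕ.+ sum (map count ys)
                    ≡ sum (map (λ y → length (filter (λ x → R? x y) (x ∷ xs))) ys)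
    step []       = refl
    step (y ∷ ys) with does (R? x y)
    ... | true  = cong suc (trans (swap y ys) (cong (count y ℕ.+_) (step ys)))
    ... | false = trans (swap y ys) (cong (count y ℕ.+_) (step ys))

sum-indicator : {E : Pred A p} (E? : Decidable E) (f : A → ℕ) (s : ℕ) →
                (∀ {x} → E x → f x ≡ s) → (∀ {x} → ¬ E x → f x ≡ 0) →
                ∀ xs → sum (map f xs) ≡ length (filter E? xs) ℕ.* s
sum-indicator E? f s f≡s f≡0 []       = refl
sum-indicator E? f s f≡s f≡0 (x ∷ xs) with E? x
... | yes px = cong₂ ℕ._+_ (f≡s px) (sum-indicator E? f s f≡s f≡0 xs)
... | no ¬px = cong₂ ℕ._+_ (f≡0 ¬px) (sum-indicator E? f s f≡s f≡0 xs)

-- Counting points of `Fin n`.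

allFin-suc : ∀ n → allFin (suc n) ≡ zero ∷ map suc (allFin n)
allFin-suc n = cong (zero ∷_) (sym (map-tabulate id suc))

length-filter-≟ : ∀ {n} (i : Fin n) → length (filter (_≟ i) (allFin n)) ≡ 1
length-filter-≟ {suc n} zero    =
  trans (cong (length ∘ filter (_≟ zero)) (allFin-suc n))
    (cong (suc ∘ length)
      (filter-none (_≟ zero) (All.map⁺ (All.universal (λ _ ()) (allFin n)))))
length-filter-≟ {suc n} (suc i) =
  trans (cong (length ∘ filter (_≟ suc i)) (allFin-suc n))
    (trans (length-filter-map (_≟ suc i) suc (allFin n))
      (trans (cong length (filter-≐ (λ j → suc j ≟ suc i) (_≟ i) (suc-injective , cong suc) (allFin n)))
        (length-filter-≟ i)))

length-filter-<? : ∀ {n} (i : Fin n) → length (filter (i <?_) (allFin n)) ≡ n ∸ suc (toℕ i)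
length-filter-<? {suc n} zero    =
  trans (cong (length ∘ filter (zero {n} <?_)) (allFin-suc n))
    (trans (cong length
        (filter-all (zero {n} <?_) (All.map⁺ (All.universal (λ _ → s≤s z≤n) (allFin n)))))
      (trans (length-map suc (allFin n)) (length-tabulate id)))
length-filter-<? {suc n} (suc i) =
  trans (cong (length ∘ filter (suc i <?_)) (allFin-suc n))
    (trans (length-filter-map (suc i <?_) suc (allFin n))
      (trans (cong length (filter-≐ (λ j → suc i <? suc j) (i <?_) (ℕ.s≤s⁻¹ , s≤s) (allFin n)))
        (length-filter-<? i)))

-- Permutations that realise a given switch.

switch? : ∀ {n} (i j : Fin n) → Decidable (Switch i j)
switch? i j π = all? (λ t → (t <? i) →-dec (π ⟨$⟩ʳ t ≟ t)) ×-dec (π ⟨$⟩ʳ j ≟ i)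

-- Both `a` and `i` are sent to `b`, so applying the inverse identifies them.
insert⁻¹ : ∀ {n} {a i b} (π : Permutation′ n) → insert a b π ⟨$⟩ʳ i ≡ b → a ≡ i
insert⁻¹ {a = a} {i} {b} π eq = trans (sym (inverseˡ (insert a b π)))
  (trans (cong (insert a b π ⟨$⟩ˡ_) (trans (insert-at a b π) (sym eq)))
    (inverseˡ (insert a b π)))

-- In row zero no earlier point has to be fixed; only the preimage of `zero` matters, which is the
-- first factor in the enumeration `Sym`.
switch-zero⇒ : ∀ {n j a} {π : Permutation′ n} → Switch zero j (insert a zero π) → a ≡ j
switch-zero⇒ {π = π} (_ , eq) = insert⁻¹ π eq

switch-zero⇐ : ∀ {n j a} {π : Permutation′ n} → a ≡ j → Switch zero j (insert a zero π)
switch-zero⇐ {j = j} {π = π} refl = (λ _ ()) , insert-at j zero π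

-- In a later row the point `zero` must be fixed, which forces its preimage `a` to be `zero`. The
-- inserted permutation then acts on successors as `π` does, and the switch descends by one row and
-- one column.
switch-suc⇒ : ∀ {n i j a} {π : Permutation′ n} →
              Switch (suc i) (suc j) (insert a zero π) → a ≡ zero × Switch i j π
switch-suc⇒ {i = i} {j} {a} {π} (fix , eq) with insert⁻¹ {a = a} π (fix zero (s≤s z≤n))
... | refl =
  refl ,
  (λ t t<i → suc-injective (trans (sym (insert-punchIn zero zero π t)) (fix (suc t) (s≤s t<i)))) ,
  suc-injective (trans (sym (insert-punchIn zero zero π j)) eq)

switch-suc⇐ : ∀ {n i j a} {π : Permutation′ n} →
              a ≡ zero → Switch i j π → Switch (suc i) (suc j) (insert a zero π)
switch-suc⇐ {i = i} {j} {π = π} refl (fix , eq) =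
  (λ { zero    _         → insert-at zero zero π
     ; (suc t) (s≤s t<i) → trans (insert-punchIn zero zero π t) (cong suc (fix t t<i)) }) ,
  trans (insert-punchIn zero zero π j) (cong suc eq)

-- Each row before `i` leaves one choice for the first factor of `Sym`. At row zero that factor is
-- the column, and the remaining permutation is arbitrary. The diagonal `j = i` is included because
-- `𝔼-c` evaluates the count there.
length-filter-switch? : ∀ {n} {i j : Fin n} → toℕ i ≤ toℕ j →
                        length (filter (switch? i j) (Sym n)) ≡ (n ∸ suc (toℕ i)) !
length-filter-switch? {suc n} {zero} {j} _ = trans
  -- The always-true predicate `U?` stands for the unconstrained second factor, which contributes
  -- all of `Sym n`.
  (length-filter-product (_≟ j) (U? {A = Permutation′ n}) (switch? zero j)
    (λ a → insert a zero)
    (λ {_} {π} sw → switch-zero⇒ {π = π} sw , tt)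
    (λ {_} {π} eq _ → switch-zero⇐ {π = π} eq)
    (allFin (suc n)) (Sym n))
  (trans
    (cong₂ ℕ._*_ (length-filter-≟ j)
      (trans (cong length (filter-all U? (All.universal (λ _ → tt) (Sym n)))) (Sym-length n)))
    (ℕ.*-identityˡ (n !)))
length-filter-switch? {suc n} {suc i} {suc j} (s≤s i≤j) = trans
  (length-filter-product (_≟ zero) (switch? i j) (switch? (suc i) (suc j))
    (λ a → insert a zero) (λ {_} {π} → switch-suc⇒ {π = π}) (λ {_} {π} → switch-suc⇐ {π = π})
    (allFin (suc n)) (Sym n))
  (trans
    (cong₂ ℕ._*_ (length-filter-≟ {suc n} zero) (length-filter-switch? {i = i} {j} i≤j))
    (ℕ.*-identityˡ _))

-- The total of `c` over a sample space.

sum-c : ∀ {n} (i : Fin n) (Ω : List (List (Permutation′ n))) (s : ℕ) →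
        (∀ {j} → i < j → length (filter (∁? (any? (switch? i j))) Ω) ≡ s) →
        sum (map (c i) Ω) ≡ (n ∸ suc (toℕ i)) ℕ.* (length Ω ∸ s)
sum-c {n} i Ω s avoid = begin
  sum (map (c i) Ω)
    ≡⟨ double-count (λ G j → nonTrivial? G i j) Ω (allFin n) ⟩
  sum (map (λ j → length (filter (λ G → nonTrivial? G i j) Ω)) (allFin n))
    ≡⟨ sum-indicator (i <?_) _ (length Ω ∸ s)
         -- Right of the diagonal `NonTrivial` amounts to its `Any` part, so the hits are all lists
         -- minus the `s` misses; the other columns contribute zero.
         (λ {j} i<j → trans
           (cong length (filter-≐ (λ G → nonTrivial? G i j) (any? (switch? i j))
             (proj₂ , (i<j ,_)) Ω))
           (trans (length-filter-∸ (any? (switch? i j)) Ω) (cong (length Ω ∸_) (avoid i<j))))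
         (λ {j} i≮j → cong length
           (filter-none (λ G → nonTrivial? G i j) (All.universal (λ _ nt → i≮j (proj₁ nt)) Ω)))
         (allFin n) ⟩
  length (filter (i <?_) (allFin n)) ℕ.* (length Ω ∸ s)
    ≡⟨ cong (ℕ._* (length Ω ∸ s)) (length-filter-<? i) ⟩
  (n ∸ suc (toℕ i)) ℕ.* (length Ω ∸ s) ∎
  where open ≡-Reasoning

-- Binomial coefficients.

C-nonZero : ∀ {n k} → k ≤ n → NonZero (n C k)
C-nonZero {k = zero}      z≤n       = _
C-nonZero {suc n} {suc k} (s≤s k≤n) = subst NonZero (nCk+nC[k+1]≡[n+1]C[k+1] n k)
  (ℕ.>-nonZero (ℕ.m≤n⇒m≤n+o _ (>-nonZero⁻¹ (n C k) {{C-nonZero k≤n}})))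

absorption : ∀ n k → suc k ℕ.* (suc n C suc k) ≡ suc n ℕ.* (n C k)
absorption zero    zero    = refl
absorption zero    (suc k) = ℕ.*-zeroʳ (suc (suc k))
absorption (suc n) zero    =
  trans (ℕ.*-identityˡ _) (trans (nC1≡n (suc (suc n))) (sym (ℕ.*-identityʳ _)))
absorption (suc n) (suc k) = begin
  suc (suc k) ℕ.* (suc (suc n) C suc (suc k))
    ≡⟨ cong (suc (suc k) ℕ.*_) (nCk+nC[k+1]≡[n+1]C[k+1] (suc n) (suc k)) ⟨
  suc (suc k) ℕ.* (suc n C suc k ℕ.+ suc n C suc (suc k))
    -- The induction hypothesis for the first coefficient takes only the factor `suc k`. The copy
    -- left over raises `suc n` to `suc (suc n)` at the end.
    ≡⟨ expand k (suc n C suc k) _ ⟩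
  suc n C suc k ℕ.+ suc k ℕ.* (suc n C suc k) ℕ.+ suc (suc k) ℕ.* (suc n C suc (suc k))
    ≡⟨ cong₂ ℕ._+_ (cong (suc n C suc k ℕ.+_) (absorption n k)) (absorption n (suc k)) ⟩
  suc n C suc k ℕ.+ suc n ℕ.* (n C k) ℕ.+ suc n ℕ.* (n C suc k)
    ≡⟨ collect n (suc n C suc k) (n C k) (n C suc k) ⟩
  suc n C suc k ℕ.+ suc n ℕ.* (n C k ℕ.+ n C suc k)
    ≡⟨ cong (λ z → suc n C suc k ℕ.+ suc n ℕ.* z) (nCk+nC[k+1]≡[n+1]C[k+1] n k) ⟩
  suc (suc n) ℕ.* (suc n C suc k) ∎
  where
  open ≡-Reasoning
  expand : ∀ k x y → suc (suc k) ℕ.* (x ℕ.+ y) ≡ x ℕ.+ suc k ℕ.* x ℕ.+ suc (suc k) ℕ.* y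
  expand = solve-∀
  collect : ∀ n x y z → x ℕ.+ suc n ℕ.* y ℕ.+ suc n ℕ.* z ≡ x ℕ.+ suc n ℕ.* (y ℕ.+ z)
  collect = solve-∀

-- Arithmetic of fractions and the product formula.

/-cross : ∀ x m y n .{{_ : NonZero m}} .{{_ : NonZero n}} →
          x ℕ.* n ≡ y ℕ.* m → + x / m ≡ + y / n
-- Since `/` normalises, the comparison is made between unnormalised fractions, whose equivalence is
-- cross multiplication.
/-cross x (suc m) y (suc n) eq = ℚ.fromℚᵘ-cong {mkℚᵘ (+ x) m} {mkℚᵘ (+ y) n}
  (*≡* (trans (sym (ℤ.pos-* x (suc n))) (trans (cong +_ eq) (ℤ.pos-* y (suc m)))))

/-* : ∀ x m y n .{{_ : NonZero m}} .{{_ : NonZero n}} .{{_ : NonZero (m ℕ.* n)}} →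
      (+ x / m) * (+ y / n) ≡ + (x ℕ.* y) / (m ℕ.* n)
/-* x (suc m) y (suc n) = ℚ.toℚᵘ-injective (begin
  toℚᵘ ((+ x / suc m) * (+ y / suc n))
    ≈⟨ ℚ.toℚᵘ-homo-* (+ x / suc m) (+ y / suc n) ⟩
  toℚᵘ (+ x / suc m) ℚᵘ.* toℚᵘ (+ y / suc n)
    ≈⟨ ℚᵘ.*-cong (ℚ.toℚᵘ-fromℚᵘ (mkℚᵘ (+ x) m)) (ℚ.toℚᵘ-fromℚᵘ (mkℚᵘ (+ y) n)) ⟩
  mkℚᵘ (+ x) m ℚᵘ.* mkℚᵘ (+ y) n
    ≡⟨ cong (λ z → mkℚᵘ z _) (ℤ.pos-* x y) ⟨
  mkℚᵘ (+ (x ℕ.* y)) _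
    ≈⟨ ℚ.toℚᵘ-fromℚᵘ _ ⟨
  toℚᵘ (+ (x ℕ.* y) / (suc m ℕ.* suc n)) ∎)
  where open ℚᵘ.≃-Reasoning

/-+ : ∀ x y n .{{_ : NonZero n}} → (+ x / n) ℚ.+ (+ y / n) ≡ + (x ℕ.+ y) / n
/-+ x y (suc n) = ℚ.toℚᵘ-injective (begin
  toℚᵘ ((+ x / suc n) ℚ.+ (+ y / suc n))
    ≈⟨ ℚ.toℚᵘ-homo-+ (+ x / suc n) (+ y / suc n) ⟩
  toℚᵘ (+ x / suc n) ℚᵘ.+ toℚᵘ (+ y / suc n)
    ≈⟨ ℚᵘ.+-cong (ℚ.toℚᵘ-fromℚᵘ (mkℚᵘ (+ x) n)) (ℚ.toℚᵘ-fromℚᵘ (mkℚᵘ (+ y) n)) ⟩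
  mkℚᵘ (+ x) n ℚᵘ.+ mkℚᵘ (+ y) n
    -- The unnormalised sum has the square of `suc n` as denominator; distributivity takes one
    -- factor out of its numerator.
    ≈⟨ *≡* (trans (cong (ℤ._* + suc n) (sym (ℤ.*-distribʳ-+ (+ suc n) (+ x) (+ y))))
         (ℤ.*-assoc (+ x ℤ.+ + y) (+ suc n) (+ suc n))) ⟩
  mkℚᵘ (+ (x ℕ.+ y)) n
    ≈⟨ ℚ.toℚᵘ-fromℚᵘ _ ⟨
  toℚᵘ (+ (x ℕ.+ y) / suc n) ∎)
  where open ℚᵘ.≃-Reasoning

1-/ : ∀ {x y n} .{{_ : NonZero n}} → x ℕ.+ y ≡ n → 1ℚ - (+ x / n) ≡ + y / n
1-/ {x} {y} {n} eq = begin
  1ℚ - (+ x / n)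
    ≡⟨ cong (_- (+ x / n)) (/-cross 1 1 n n (ℕ.*-comm 1 n)) ⟩
  (+ n / n) - (+ x / n)
    ≡⟨ cong (λ z → (+ z / n) - (+ x / n)) (trans (sym eq) (ℕ.+-comm x y)) ⟩
  (+ (y ℕ.+ x) / n) - (+ x / n)
    ≡⟨ cong (_- (+ x / n)) (/-+ y x n) ⟨
  ((+ y / n) ℚ.+ (+ x / n)) - (+ x / n)
    ≡⟨ ℚ.+-assoc (+ y / n) (+ x / n) (ℚ.- (+ x / n)) ⟩
  (+ y / n) ℚ.+ ((+ x / n) - (+ x / n))
    ≡⟨ cong ((+ y / n) ℚ.+_) (ℚ.+-inverseʳ (+ x / n)) ⟩
  (+ y / n) ℚ.+ ℚ.0ℚ
    ≡⟨ ℚ.+-identityʳ (+ y / n) ⟩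
  + y / n ∎
  where open ≡-Reasoning

/-^ : ∀ x n k .{{_ : NonZero n}} .{{_ : NonZero (n ℕ.^ k)}} →
      (+ x / n) ^ k ≡ + (x ℕ.^ k) / (n ℕ.^ k)
/-^ x n zero    = refl
/-^ x n (suc k) =
  trans (cong ((+ x / n) *_) (/-^ x n k)) (/-* x n (x ℕ.^ k) (n ℕ.^ k))
  where instance _ = ℕ.m^n≢0 n k

-- The product stays right when l < k: both sides vanish, the factor at t = l being 1 - m/m.
∏-binomial : ∀ m l {n} k → m ℕ.+ l ≡ n → (k≤n : k ≤ n) .{{_ : NonZero (n C k)}} →
             ∏ {k} (λ t → let instance _ = ∸-nonZero k≤n t in 1ℚ - (+ m / (n ∸ toℕ t)))
               ≡ + (l C k) / (n C k)
∏-binomial m l       zero    eq k≤n = refl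
∏-binomial m zero    {suc n} (suc k) eq k≤n = begin
  (1ℚ - (+ m / suc n)) * rest
    ≡⟨ cong (_* rest) (1-/ {m} {0} {suc n} eq) ⟩
  (+ 0 / suc n) * rest
    ≡⟨ cong (_* rest) (/-cross 0 (suc n) 0 1 refl) ⟩
  ℚ.0ℚ * rest
    ≡⟨ ℚ.*-zeroˡ rest ⟩
  ℚ.0ℚ
    ≡⟨ /-cross 0 1 0 (suc n C suc k) refl ⟩
  + 0 / (suc n C suc k) ∎
  where
  open ≡-Reasoning
  rest : ℚ
  rest = ∏ {k} (λ t → let instance _ = ∸-nonZero (ℕ.s≤s⁻¹ k≤n) t in 1ℚ - (+ m / (n ∸ toℕ t)))
∏-binomial m (suc l) {suc n} (suc k) eq (s≤s k≤n) = begin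
  (1ℚ - (+ m / suc n)) * rest
    -- As `suc n ∸ suc t` reduces to `n ∸ t`, the remaining factors form the product for `n` and `l`
    -- with the same `m`.
    ≡⟨ cong₂ _*_ (1-/ {m} {suc l} {suc n} eq)
         (∏-binomial m l k (ℕ.suc-injective (trans (sym (ℕ.+-suc m l)) eq)) k≤n) ⟩
  (+ suc l / suc n) * (+ (l C k) / (n C k))
    ≡⟨ /-* (suc l) (suc n) (l C k) (n C k) ⟩
  + (suc l ℕ.* (l C k)) / (suc n ℕ.* (n C k))
    ≡⟨ /-cross (suc l ℕ.* (l C k)) (suc n ℕ.* (n C k)) (suc l C suc k) (suc n C suc k) cross ⟩
  + (suc l C suc k) / (suc n C suc k) ∎
  where
  open ≡-Reasoning
  instance
    nCk≢0 : NonZero (n C k)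
    nCk≢0 = C-nonZero k≤n
    snC≢0 : NonZero (suc n ℕ.* (n C k))
    snC≢0 = ℕ.m*n≢0 (suc n) (n C k)
  rest : ℚ
  rest = ∏ {k} (λ t → let instance _ = ∸-nonZero k≤n t in 1ℚ - (+ m / (n ∸ toℕ t)))
  rearrange : ∀ k x y → suc k ℕ.* x ℕ.* y ≡ x ℕ.* (suc k ℕ.* y)
  rearrange = solve-∀
  cross : suc l ℕ.* (l C k) ℕ.* (suc n C suc k) ≡ (suc l C suc k) ℕ.* (suc n ℕ.* (n C k))
  cross = begin
    suc l ℕ.* (l C k) ℕ.* (suc n C suc k)
      ≡⟨ cong (ℕ._* (suc n C suc k)) (absorption l k) ⟨
    suc k ℕ.* (suc l C suc k) ℕ.* (suc n C suc k)
      -- Absorption in `l` and in `n` involves the same factor `suc k`, so it can pass from one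
      -- coefficient to the other.
      ≡⟨ rearrange k (suc l C suc k) (suc n C suc k) ⟩
    (suc l C suc k) ℕ.* (suc k ℕ.* (suc n C suc k))
      ≡⟨ cong ((suc l C suc k) ℕ.*_) (absorption n k) ⟩
    (suc l C suc k) ℕ.* (suc n ℕ.* (n C k)) ∎

-- The expectation of `c` for subsets and for sequences.

P*[n∸k]! : ∀ {n k} → k ≤ n → (n P k) ℕ.* (n ∸ k) ! ≡ n !
P*[n∸k]! {n} {k} k≤n = trans
  (cong (ℕ._* (n ∸ k) !) (nPk≡n!/[n∸k]! k≤n))
  (m/n*n≡m (m≤n⇒m!∣n! (ℕ.m∸n≤m n k)))
  where instance _ = (n ∸ k) ℕ.!≢0

-- Common to both models: the sample space enters only through its size and the number `s` of lists
-- that miss a column, the same for every column.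
𝔼-c : ∀ {n} (i : Fin n) (Ω : List (List (Permutation′ n))) (s : ℕ) .{{_ : NonZero (length Ω)}} →
      (∀ {j} → toℕ i ≤ toℕ j → length (filter (∁? (any? (switch? i j))) Ω) ≡ s) →
      𝔼 Ω (c i) ≡ (+ (n ∸ suc (toℕ i)) / 1) * (1ℚ - (+ s / length Ω))
𝔼-c {n} i Ω s avoid = begin
  + sum (map (c i) Ω) / length Ω
    ≡⟨ cong (λ z → + z / length Ω) (sum-c i Ω s (λ {j} i<j → avoid {j} (ℕ.<⇒≤ i<j))) ⟩
  + (m ℕ.* (length Ω ∸ s)) / length Ω
    -- The denominator becomes `1 * length Ω` to fit the product rule `/-*`.
    ≡⟨ /-cross (m ℕ.* (length Ω ∸ s)) (length Ω) (m ℕ.* (length Ω ∸ s)) (1 ℕ.* length Ω)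
         (cong (m ℕ.* (length Ω ∸ s) ℕ.*_) (ℕ.*-identityˡ (length Ω))) ⟩
  + (m ℕ.* (length Ω ∸ s)) / (1 ℕ.* length Ω)
    ≡⟨ /-* m 1 (length Ω ∸ s) (length Ω) ⟨
  (+ m / 1) * (+ (length Ω ∸ s) / length Ω)
    ≡⟨ cong ((+ m / 1) *_) (1-/ {s} (ℕ.m+[n∸m]≡n s≤Ω)) ⟨
  (+ m / 1) * (1ℚ - (+ s / length Ω)) ∎
  where
  open ≡-Reasoning
  m : ℕ
  m = n ∸ suc (toℕ i)
  -- The last row has no column j > i, so the bound is read off the diagonal j = i.
  s≤Ω : s ≤ length Ω
  s≤Ω = subst (_≤ length Ω) (avoid {i} ℕ.≤-refl) (length-filter (∁? (any? (switch? i i))) Ω)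
  instance _ = ℕ.m*n≢0 1 (length Ω)

module _ {n} (k : ℕ) (i : Fin n) where

  private
    r N m l : ℕ
    r = suc (toℕ i)
    N = n !
    m = (n ∸ r) !
    l = n ! ∸ m

    m≤N : m ≤ N
    m≤N = ∣⇒≤ {{n ℕ.!≢0}} (m≤n⇒m!∣n! (ℕ.m∸n≤m n r))

    avoid : ∀ {j} → toℕ i ≤ toℕ j → length (filter (∁? (switch? i j)) (Sym n)) ≡ l
    avoid {j} i≤j = trans (sym (ℕ.m+n∸m≡n (length (filter (switch? i j) (Sym n))) _))
      (cong₂ _∸_ (trans (length-filter-∁ (switch? i j) (Sym n)) (Sym-length n))
                 (length-filter-switch? {i = i} {j} i≤j))

  𝔼-subsets : (k≤n! : k ≤ n !) →
    let instance _ = Sym-subsets-nonZero {n} k≤n! in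
    𝔼 (subsets k (Sym n)) (c i)
      ≡ (+ (n ∸ r) / 1)
        * (1ℚ - ∏ {k} (λ t → let instance _ = ∸-nonZero k≤n! t in 1ℚ - (+ m / (n ! ∸ toℕ t))))
  𝔼-subsets k≤n! = trans
    (𝔼-c i (subsets k (Sym n)) (l C k)
      (λ {j} i≤j → trans (subsets-none (switch? i j) k (Sym n)) (cong (_C k) (avoid {j} i≤j))))
    (cong (λ z → (+ (n ∸ r) / 1) * (1ℚ - z)) (trans
      -- With its denominator rewritten by `len`, the probability of a miss is the quotient of
      -- binomials from `∏-binomial`.
      (ℚ./-cong {p₁ = + (l C k)} refl len)
      (sym (∏-binomial m l k (ℕ.m+[n∸m]≡n m≤N) k≤n!))))
    where
    len : length (subsets k (Sym n)) ≡ n ! C k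
    len = trans (subsets-length k (Sym n)) (cong (_C k) (Sym-length n))
    instance
      _ = Sym-subsets-nonZero {n} k≤n!
      N≢0 : NonZero (n ! C k)
      N≢0 = subst NonZero len (Sym-subsets-nonZero {n} k≤n!)

  𝔼-sequences :
    let instance
          _ = Sym-sequences-nonZero n k
          _ = P-nonZero (toℕ<n i)
    in
    𝔼 (sequences k (Sym n)) (c i)
      ≡ (+ (n ∸ r) / 1) * (1ℚ - (1ℚ - (+ 1 / (n P r))) ^ k)
  𝔼-sequences = trans
    (𝔼-c i (sequences k (Sym n)) (l ℕ.^ k)
      (λ {j} i≤j → trans (sequences-none (switch? i j) k (Sym n)) (cong (ℕ._^ k) (avoid {j} i≤j))))
    (cong (λ z → (+ (n ∸ r) / 1) * (1ℚ - z)) (begin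
      + (l ℕ.^ k) / length (sequences k (Sym n))
        ≡⟨ ℚ./-cong {p₁ = + (l ℕ.^ k)} refl len ⟩
      + (l ℕ.^ k) / (N ℕ.^ k)
        ≡⟨ /-^ l N k ⟨
      (+ l / N) ^ k
        ≡⟨ cong (_^ k) (1-/ {m} (ℕ.m+[n∸m]≡n m≤N)) ⟨
      (1ℚ - (+ m / N)) ^ k
        -- The factorial `m` cancels, as `n P r` times `m` is `N`.
        ≡⟨ cong (λ z → (1ℚ - z) ^ k) (/-cross m N 1 (n P r) cross) ⟩
      (1ℚ - (+ 1 / (n P r))) ^ k ∎))
    where
    open ≡-Reasoning
    len : length (sequences k (Sym n)) ≡ N ℕ.^ k
    len = trans (sequences-length k (Sym n)) (cong (ℕ._^ k) (Sym-length n))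
    cross : m ℕ.* (n P r) ≡ 1 ℕ.* N
    cross = trans (ℕ.*-comm m (n P r)) (trans (P*[n∸k]! (toℕ<n i)) (sym (ℕ.*-identityˡ N)))
    instance
      _ = Sym-sequences-nonZero n k
      _ = P-nonZero (toℕ<n i)
      _ = n ℕ.!≢0
      _ = ℕ.m^n≢0 N k

theorem4 :
  (n k : ℕ) (i : Fin n) →
  let r = suc (toℕ i) in
  ( (k≤n! : k ≤ n !) →
    let instance _ = Sym-subsets-nonZero {n} k≤n! in
    𝔼 (subsets k (Sym n)) (c i)
      ≡ (+ (n ∸ r) / 1)
        * (1ℚ - ∏ {k} (λ t → let instance _ = ∸-nonZero k≤n! t in
                             1ℚ - (+ ((n ∸ r) !) / (n ! ∸ toℕ t)))) )
  ×
  ( let instance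
          _ = Sym-sequences-nonZero n k
          _ = P-nonZero (toℕ<n i)
    in
    𝔼 (sequences k (Sym n)) (c i)
      ≡ (+ (n ∸ r) / 1) * (1ℚ - (1ℚ - (+ 1 / (n P r))) ^ k) )
theorem4 n k i = 𝔼-subsets k i , 𝔼-sequences k i
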